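{- Let $d\in\mathbb N$ and let $w\in\mathbb Z^{V_d}$ be a valid outcome with $\#\mathrm{supp}^+(w)=5$. Then $\deg(w)\leq 7$.
   Context: $V_d=\{(i,j)\in\mathbb Z_{\geq0}^2\mid i+j\leq d\}$, $\deg(i,j)=i+j$. A chip configuration is $w\in\mathbb Z^{V_d}$. A splitting move at $p\in V_{d-1}$ decreases $w_p$ by $1$ and increases $w_{p+(1,0)}$, $w_{p+(0,1)}$ by $1$; an unsplitting move is its inverse. An outcome is a configuration reachable from the zero configuration by finitely many moves. $\mathrm{supp}^+(w)=\{(i,j)\mid w_{i,j}>0\}$, $\mathrm{supp}(w)=\{(i,j)\mid w_{i,j}\neq 0\}$, $\deg(w)=\max\{i+j\mid (i,j)\in\mathrm{supp}(w)\}$; $w$ is valid if $w_{i,j}\geq 0$ for all $(i,j)\neq(0,0)$. -}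

module Defs where

open import Data.Nat using (ℕ; zero; suc; _+_; _≤_; _<_)
import Data.Nat as ℕ
open import Data.Integer using (ℤ; 0ℤ; 1ℤ) renaming (_+_ to _+ℤ_; _-_ to _-ℤ_; _≤_ to _≤ℤ_; _<_ to _<ℤ_)
import Data.Integer as ℤ
open import Data.Bool using (Bool; true; false; _∧_)
open import Data.List using (List; []; _∷_; _++_; map; concatMap; filter; length; upTo)
open import Data.Product using (_×_; _,_; ∃; Σ)
open import Relation.Nullary using (¬_; does)
open import Relation.Binary.PropositionalEquality using (_≡_)

-- A chip configuration: a function on pairs of naturals (values outside V_d
-- are irrelevant; outcomes are automatically zero there).
Config : Set
Config = ℕ → ℕ → ℤ

at : ℕ → ℕ → ℕ → ℕ → ℤ
at p q a b with does (a ℕ.≟ p) ∧ does (b ℕ.≟ q)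
... | true  = 1ℤ
... | false = 0ℤ

split : ℕ → ℕ → Config → Config
split i j w a b = ((w a b -ℤ at i j a b) +ℤ at (suc i) j a b) +ℤ at i (suc j) a b

unsplit : ℕ → ℕ → Config → Config
unsplit i j w a b = ((w a b +ℤ at i j a b) -ℤ at (suc i) j a b) -ℤ at i (suc j) a b

zeroConfig : Config
zeroConfig _ _ = 0ℤ

data Reachable (d : ℕ) : Config → Set where
  start     : Reachable d zeroConfig
  splitMv   : ∀ {w} i j → i + j < d → Reachable d w → Reachable d (split i j w)
  unsplitMv : ∀ {w} i j → i + j < d → Reachable d w → Reachable d (unsplit i j w)

Outcome : ℕ → Config → Set
Outcome d w = Σ Config λ v → Reachable d v × (∀ i j → v i j ≡ w i j)

Valid : Config → Set
Valid w = ∀ i j → ¬ (i ≡ 0 × j ≡ 0) → 0ℤ ≤ℤ w i j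

Vpts : ℕ → List (ℕ × ℕ)
Vpts d = concatMap (λ s → map (λ i → (i , s ℕ.∸ i)) (upTo (suc s))) (upTo (suc d))

suppPlusCard : ℕ → Config → ℕ
suppPlusCard d w = length (filter (λ p → 0ℤ ℤ.<? w (Data.Product.proj₁ p) (Data.Product.proj₂ p)) (Vpts d))

DegLe : Config → ℕ → Set
DegLe w n = ∀ i j → ¬ (w i j ≡ 0ℤ) → i + j ≤ n

{-# OPTIONS --safe #-}
module Submission where

-- Let q count the splitting moves at each point, so that w(i,j) = q(i-1,j) + q(i,j-1) - q(i,j),
-- and let n be the last antidiagonal on which q is nonzero. Replace q by signs. Going from one
-- antidiagonal to the next, the number of sign changes grows by at most twice the number of
-- interior points whose two predecessors have the same sign, opposite to their own; at such a
-- point w ≠ 0, so w > 0. On antidiagonal n + 1, where q = 0, equal neighbours on antidiagonal n force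
-- w > 0. Hence n ≤ 2 #{interior points with w > 0}. Each of the two legs carries at least one
-- more positive point, since q(0,0) > 0 decreases to 0 along it; so n + 4 ≤ 2 #supp⁺(w).
-- The zeros of q need signs for which a vanishing triple is never such a point. Every
-- antidiagonal up to n has a point with q > 0; zeros to the left of it copy the sign above
-- them, those to the right the sign to their right, and on antidiagonal n zeros alternate.

open import Defs
open import Data.Nat using (ℕ; zero; suc; _+_; _*_; _∸_; _≤_; _<_; z≤n; s≤s; s≤s⁻¹)
import Data.Nat as ℕ
import Data.Nat.Properties as ℕ
open import Data.Nat.Tactic.RingSolver using (solve-∀)
open import Data.Integer using (ℤ; +_; -[1+_]; 0ℤ; +≤+; -≤+) renaming (_+_ to _+ℤ_; _-_ to _-ℤ_; _≤_ to _≤ℤ_; _<_ to _<ℤ_)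
import Data.Integer as ℤ
import Data.Integer.Properties as ℤ
import Data.Integer.Tactic.RingSolver as ℤ-Solver
open import Data.Bool using (Bool; true; false; T; not; if_then_else_)
open import Data.Bool.Properties using (∧-zeroʳ)
open import Data.List using (List; []; _∷_; _++_; map; concatMap; filter; length; upTo; [_])
open import Data.List.Properties using (upTo-∷ʳ; concatMap-++; filter-++; length-++; map-++; ++-identityʳ)
open import Data.Product using (_×_; _,_; ∃-syntax; proj₁; proj₂)
open import Data.Sum using (_⊎_; inj₁; inj₂)
open import Function using (_∘_)
open import Relation.Nullary using (yes; no; does; contradiction)
open import Relation.Nullary.Decidable using (¬?; decidable-stable)
open import Level using (0ℓ)
open import Relation.Unary using (Pred; Decidable)
open import Relation.Binary.PropositionalEquality using (_≡_; _≢_; refl; sym; trans; cong; cong₂; subst; subst₂; module ≡-Reasoning)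

-- Finite sums and the count of positive points

∑ : ℕ → (ℕ → ℕ) → ℕ
∑ zero    f = 0
∑ (suc n) f = ∑ n f + f n

∑-cong : ∀ n {f g : ℕ → ℕ} → (∀ i → f i ≡ g i) → ∑ n f ≡ ∑ n g
∑-cong zero    h = refl
∑-cong (suc n) h = cong₂ _+_ (∑-cong n h) (h n)

∑-mono : ∀ n {f g : ℕ → ℕ} → (∀ i → i < n → f i ≤ g i) → ∑ n f ≤ ∑ n g
∑-mono zero    h = z≤n
∑-mono (suc n) h = ℕ.+-mono-≤ (∑-mono n λ i i<n → h i (ℕ.m<n⇒m<1+n i<n)) (h n ℕ.≤-refl)

∑-monoˡ : ∀ {m n} (f : ℕ → ℕ) → m ≤ n → ∑ m f ≤ ∑ n f
∑-monoˡ {n = zero}  f z≤n = z≤n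
∑-monoˡ {n = suc n} f m≤n with ℕ.m≤n⇒m<n∨m≡n m≤n
... | inj₁ m<n  = ℕ.≤-trans (∑-monoˡ f (s≤s⁻¹ m<n)) (ℕ.m≤m+n _ _)
... | inj₂ refl = ℕ.≤-refl

∑-+ : ∀ n (f g : ℕ → ℕ) → ∑ n (λ i → f i + g i) ≡ ∑ n f + ∑ n g
∑-+ zero    f g = refl
∑-+ (suc n) f g rewrite ∑-+ n f g = shuffle (∑ n f) (∑ n g) (f n) (g n)
  where
  shuffle : ∀ a b c d → a + b + (c + d) ≡ a + c + (b + d)
  shuffle = solve-∀

∑-suc : ∀ n (f : ℕ → ℕ) → ∑ (suc n) f ≡ f 0 + ∑ n (f ∘ suc)
∑-suc zero    f = ℕ.+-comm 0 (f 0)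
∑-suc (suc n) f rewrite ∑-suc n f = ℕ.+-assoc (f 0) (∑ n (f ∘ suc)) (f (suc n))

⟦_>0⟧ : ℤ → ℕ
⟦ z >0⟧ = if does (0ℤ ℤ.<? z) then 1 else 0

module _ {A : Set} {P : Pred A 0ℓ} (P? : Decidable P) where

  count : List A → ℕ
  count = length ∘ filter P?

  count-++ : ∀ xs ys → count (xs ++ ys) ≡ count xs + count ys
  count-++ xs ys = trans (cong length (filter-++ P? xs ys)) (length-++ (filter P? xs))

  count-[] : ∀ x → count [ x ] ≡ (if does (P? x) then 1 else 0)
  count-[] x with does (P? x)
  ... | true  = refl
  ... | false = refl

  count-map-upTo : ∀ (f : ℕ → A) n →
    count (map f (upTo n)) ≡ ∑ n (λ i → if does (P? (f i)) then 1 else 0)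
  count-map-upTo f zero = refl
  count-map-upTo f (suc n) = begin
    count (map f (upTo (suc n)))         ≡⟨ cong (count ∘ map f) (upTo-∷ʳ n) ⟨
    count (map f (upTo n ++ [ n ]))      ≡⟨ cong count (map-++ f (upTo n) [ n ]) ⟩
    count (map f (upTo n) ++ [ f n ])    ≡⟨ count-++ (map f (upTo n)) [ f n ] ⟩
    count (map f (upTo n)) + count [ f n ]
                                         ≡⟨ cong₂ _+_ (count-map-upTo f n) (count-[] (f n)) ⟩
    ∑ (suc n) (λ i → if does (P? (f i)) then 1 else 0) ∎
    where open ≡-Reasoning

  count-concatMap-upTo : ∀ (F : ℕ → List A) n →
    count (concatMap F (upTo n)) ≡ ∑ n (count ∘ F)
  count-concatMap-upTo F zero = refl
  count-concatMap-upTo F (suc n) = begin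
    count (concatMap F (upTo (suc n)))           ≡⟨ cong (count ∘ concatMap F) (upTo-∷ʳ n) ⟨
    count (concatMap F (upTo n ++ [ n ]))        ≡⟨ cong count (concatMap-++ F (upTo n) [ n ]) ⟩
    count (concatMap F (upTo n) ++ (F n ++ []))  ≡⟨ cong (λ ys → count (concatMap F (upTo n) ++ ys)) (++-identityʳ (F n)) ⟩
    count (concatMap F (upTo n) ++ F n)          ≡⟨ count-++ (concatMap F (upTo n)) (F n) ⟩
    count (concatMap F (upTo n)) + count (F n)   ≡⟨ cong (_+ count (F n)) (count-concatMap-upTo F n) ⟩
    ∑ (suc n) (count ∘ F)                        ∎
    where open ≡-Reasoning

-- `Vpts` lists the triangle one antidiagonal at a time, so the count splits into one sum per
-- antidiagonal.
suppPlusCard-∑ : ∀ d w →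
  suppPlusCard d w ≡ ∑ (suc d) (λ k → ∑ (suc k) (λ i → ⟦ w i (k ∸ i) >0⟧))
suppPlusCard-∑ d w =
  trans (count-concatMap-upTo P? (λ s → map (λ i → i , s ∸ i) (upTo (suc s))) (suc d))
        (∑-cong (suc d) λ k → count-map-upTo P? (λ i → i , k ∸ i) (suc k))
  where
  P? : Decidable (λ (p : ℕ × ℕ) → 0ℤ <ℤ w (proj₁ p) (proj₂ p))
  P? p = 0ℤ ℤ.<? w (proj₁ p) (proj₂ p)

-- Potential of an outcome

left below : Config → Config
left  q zero    j = 0ℤ
left  q (suc i) j = q i j
below q i zero    = 0ℤ
below q i (suc j) = q i j

-- q counts splitting moves minus unsplitting moves.
record Potential (d : ℕ) (w : Config) : Set where
  field
    q        : Config
    balance  : ∀ i j → w i j +ℤ q i j ≡ left q i j +ℤ below q i j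
    vanishes : ∀ i j → d ≤ i + j → q i j ≡ 0ℤ

at-left : ∀ p r i j → at (suc p) r i j ≡ left (at p r) i j
at-left p r zero    j = refl
at-left p r (suc i) j = refl

at-below : ∀ p r i j → at p (suc r) i j ≡ below (at p r) i j
at-below p r i zero rewrite ∧-zeroʳ (does (i ℕ.≟ p)) = refl
at-below p r i (suc j) = refl

at-off : ∀ p r i j → p + r < i + j → at p r i j ≡ 0ℤ
at-off p r i j h with i ℕ.≡ᵇ p in i≡p | j ℕ.≡ᵇ r in j≡r
... | false | _     = refl
... | true  | false = refl
... | true  | true
  rewrite ℕ.≡ᵇ⇒≡ i p (subst T (sym i≡p) _) | ℕ.≡ᵇ⇒≡ j r (subst T (sym j≡r) _) =
  contradiction h (ℕ.<-irrefl refl)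

-- The operation is a parameter because splitting moves add to the potential and unsplitting moves
-- subtract from it.
left-∙ : (_∙_ : ℤ → ℤ → ℤ) → 0ℤ ∙ 0ℤ ≡ 0ℤ → ∀ (f g : Config) i j →
  left (λ a b → f a b ∙ g a b) i j ≡ left f i j ∙ left g i j
left-∙ _∙_ e f g zero    j = sym e
left-∙ _∙_ e f g (suc i) j = refl

below-∙ : (_∙_ : ℤ → ℤ → ℤ) → 0ℤ ∙ 0ℤ ≡ 0ℤ → ∀ (f g : Config) i j →
  below (λ a b → f a b ∙ g a b) i j ≡ below f i j ∙ below g i j
below-∙ _∙_ e f g i zero    = sym e
below-∙ _∙_ e f g i (suc j) = refl

-- A move at (`p`, `r`) changes `q` by the point mass there, and `balance` is linear in `w` and `q`
-- together. As `p + r < d`, the potential stays zero from degree `d` on.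
reachable-potential : ∀ {d w} → Reachable d w → Potential d w
reachable-potential start = record
  { q = zeroConfig
  ; balance  = λ { zero zero → refl ; zero (suc _) → refl ; (suc _) zero → refl ; (suc _) (suc _) → refl }
  ; vanishes = λ _ _ _ → refl }
reachable-potential {d} (splitMv {w} p r p+r<d R) = record
  { q = λ i j → q i j +ℤ at p r i j
  ; balance = λ i j → bal i j
  ; vanishes = λ i j h → cong₂ _+ℤ_ (vanishes i j h) (at-off p r i j (ℕ.<-≤-trans p+r<d h)) }
  where
  open Potential (reachable-potential R)
  lhs : ∀ w q e l b → (w -ℤ e +ℤ l +ℤ b) +ℤ (q +ℤ e) ≡ (w +ℤ q) +ℤ (l +ℤ b)
  lhs = ℤ-Solver.solve-∀
  rhs : ∀ L B l b → (L +ℤ B) +ℤ (l +ℤ b) ≡ (L +ℤ l) +ℤ (B +ℤ b)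
  rhs = ℤ-Solver.solve-∀
  bal : ∀ i j → split p r w i j +ℤ (q i j +ℤ at p r i j)
      ≡ left (λ a b → q a b +ℤ at p r a b) i j +ℤ below (λ a b → q a b +ℤ at p r a b) i j
  bal i j rewrite left-∙ _+ℤ_ refl q (at p r) i j | below-∙ _+ℤ_ refl q (at p r) i j
    | at-left p r i j | at-below p r i j
    | lhs (w i j) (q i j) (at p r i j) (left (at p r) i j) (below (at p r) i j)
    | balance i j = rhs (left q i j) (below q i j) (left (at p r) i j) (below (at p r) i j)
reachable-potential {d} (unsplitMv {w} p r p+r<d R) = record
  { q = λ i j → q i j -ℤ at p r i j
  ; balance = λ i j → bal i j
  ; vanishes = λ i j h → cong₂ _-ℤ_ (vanishes i j h) (at-off p r i j (ℕ.<-≤-trans p+r<d h)) }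
  where
  open Potential (reachable-potential R)
  lhs : ∀ w q e l b → (w +ℤ e -ℤ l -ℤ b) +ℤ (q -ℤ e) ≡ (w +ℤ q) -ℤ (l +ℤ b)
  lhs = ℤ-Solver.solve-∀
  rhs : ∀ L B l b → (L +ℤ B) -ℤ (l +ℤ b) ≡ (L -ℤ l) +ℤ (B -ℤ b)
  rhs = ℤ-Solver.solve-∀
  bal : ∀ i j → unsplit p r w i j +ℤ (q i j -ℤ at p r i j)
      ≡ left (λ a b → q a b -ℤ at p r a b) i j +ℤ below (λ a b → q a b -ℤ at p r a b) i j
  bal i j rewrite left-∙ _-ℤ_ refl q (at p r) i j | below-∙ _-ℤ_ refl q (at p r) i j
    | at-left p r i j | at-below p r i j
    | lhs (w i j) (q i j) (at p r i j) (left (at p r) i j) (below (at p r) i j)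
    | balance i j = rhs (left q i j) (below q i j) (left (at p r) i j) (below (at p r) i j)

outcome-potential : ∀ {d w} → Outcome d w → Potential d w
outcome-potential (v , R , v≡w) = record
  { q = q
  ; balance = λ i j → trans (cong (_+ℤ q i j) (sym (v≡w i j))) (balance i j)
  ; vanishes = vanishes }
  where open Potential (reachable-potential R)

-- Sign patterns

δ : Bool → Bool → ℕ
δ false false = 0
δ true  true  = 0
δ _     _     = 1

-- The first two arguments are the signs of the predecessors on the previous antidiagonal, the third
-- is the sign of the point itself.
node : Bool → Bool → Bool → ℕ
node false false true  = 1
node true  true  false = 1
node _     _     _     = 0

node-copyʳ : ∀ a b → node a b b ≡ 0
node-copyʳ false false = refl
node-copyʳ false true  = refl
node-copyʳ true  false = refl
node-copyʳ true  true  = refl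

node-copyˡ : ∀ a b → node a b a ≡ 0
node-copyˡ false false = refl
node-copyˡ false true  = refl
node-copyˡ true  false = refl
node-copyˡ true  true  = refl

changes : ℕ → (ℕ → Bool) → ℕ
changes n σ = ∑ n (λ i → δ (σ i) (σ (suc i)))

nodes : ℕ → (ℕ → Bool) → (ℕ → Bool) → ℕ
nodes n π σ = ∑ n (λ i → node (π i) (π (suc i)) (σ (suc i)))

-- The middle of the path `c`, `p`, `p′` is replaced by `c′`. If `c′` equals `p` or `p′`, the
-- triangle inequality suffices; otherwise `p` and `p′` are equal and differ from `c′`, and the
-- detour costs at most two.
δ-step : ∀ c c′ p p′ → δ c c′ + δ c′ p′ ≤ δ c p + (δ p p′ + 2 * node p p′ c′)
δ-step false false false false = ℕ.≤ᵇ⇒≤ _ _ _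
δ-step false false false true  = ℕ.≤ᵇ⇒≤ _ _ _
δ-step false false true  false = ℕ.≤ᵇ⇒≤ _ _ _
δ-step false false true  true  = ℕ.≤ᵇ⇒≤ _ _ _
δ-step false true  false false = ℕ.≤ᵇ⇒≤ _ _ _
δ-step false true  false true  = ℕ.≤ᵇ⇒≤ _ _ _
δ-step false true  true  false = ℕ.≤ᵇ⇒≤ _ _ _
δ-step false true  true  true  = ℕ.≤ᵇ⇒≤ _ _ _
δ-step true  false false false = ℕ.≤ᵇ⇒≤ _ _ _
δ-step true  false false true  = ℕ.≤ᵇ⇒≤ _ _ _
δ-step true  false true  false = ℕ.≤ᵇ⇒≤ _ _ _
δ-step true  false true  true  = ℕ.≤ᵇ⇒≤ _ _ _
δ-step true  true  false false = ℕ.≤ᵇ⇒≤ _ _ _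
δ-step true  true  false true  = ℕ.≤ᵇ⇒≤ _ _ _
δ-step true  true  true  false = ℕ.≤ᵇ⇒≤ _ _ _
δ-step true  true  true  true  = ℕ.≤ᵇ⇒≤ _ _ _

δ-refl : ∀ b → δ b b ≡ 0
δ-refl false = refl
δ-refl true  = refl

-- Compares σ with the interleaved sequence σ 0 , π 0 , σ 1 , π 1 , …
changes-interlace : ∀ n π σ → σ 0 ≡ π 0 →
  changes n σ + δ (σ n) (π n) ≤ changes n π + 2 * nodes n π σ
changes-interlace zero    π σ σ₀ rewrite σ₀ | δ-refl (π 0) = z≤n
changes-interlace (suc n) π σ σ₀ = begin
  changes n σ + δ c c′ + δ c′ p′                                  ≡⟨ ℕ.+-assoc (changes n σ) _ _ ⟩
  changes n σ + (δ c c′ + δ c′ p′)                                ≤⟨ ℕ.+-monoʳ-≤ (changes n σ) (δ-step c c′ p p′) ⟩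
  changes n σ + (δ c p + (δ p p′ + 2 * node p p′ c′))             ≡⟨ ℕ.+-assoc (changes n σ) _ _ ⟨
  changes n σ + δ c p + (δ p p′ + 2 * node p p′ c′)               ≤⟨ ℕ.+-monoˡ-≤ _ (changes-interlace n π σ σ₀) ⟩
  changes n π + 2 * nodes n π σ + (δ p p′ + 2 * node p p′ c′)     ≡⟨ shuffle (changes n π) (nodes n π σ) _ _ ⟩
  changes n π + δ p p′ + 2 * (nodes n π σ + node p p′ c′)         ∎
  where
  open ℕ.≤-Reasoning
  c c′ p p′ : Bool
  c  = σ n
  c′ = σ (suc n)
  p  = π n
  p′ = π (suc n)
  shuffle : ∀ a b x y → a + 2 * b + (x + 2 * y) ≡ a + x + 2 * (b + y)
  shuffle = solve-∀

-- When the last signs also agree, the leftover term of the interlacing is the last change of the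
-- longer row.
changes-suc : ∀ n π σ → σ 0 ≡ π 0 → σ (suc n) ≡ π n →
  changes (suc n) σ ≤ changes n π + 2 * nodes n π σ
changes-suc n π σ σ₀ σₙ rewrite σₙ = changes-interlace n π σ σ₀

-- Signs of integers

Agrees : Bool → ℤ → Set
Agrees true  z = 0ℤ ≤ℤ z
Agrees false z = z ≤ℤ 0ℤ

-- Zero agrees with both signs; the second argument is the sign chosen for it.
fill : ℤ → Bool → Bool
fill (+ zero)  b = b
fill (+ suc _) b = true
fill -[1+ _ ]  b = false

agrees-0 : ∀ b → Agrees b 0ℤ
agrees-0 false = ℤ.≤-refl
agrees-0 true  = ℤ.≤-refl

agrees-fill : ∀ z b → Agrees (fill z b) z
agrees-fill (+ zero)  b = agrees-0 b
agrees-fill (+ suc _) b = +≤+ z≤n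
agrees-fill -[1+ _ ]  b = -≤+

agrees-true : ∀ {b z} → Agrees b z → 0ℤ <ℤ z → b ≡ true
agrees-true {true}  _   _   = refl
agrees-true {false} z≤0 0<z = contradiction 0<z (ℤ.≤⇒≯ z≤0)

fill-true : ∀ {z} → 0ℤ ≤ℤ z → fill z true ≡ true
fill-true {+ zero}  _ = refl
fill-true {+ suc _} _ = refl

fill-0 : ∀ {z} b → z ≡ 0ℤ → fill z b ≡ b
fill-0 b refl = refl

⟦>0⟧-pos : ∀ {z} → 0ℤ <ℤ z → ⟦ z >0⟧ ≡ 1
⟦>0⟧-pos {z} 0<z with 0ℤ ℤ.<? z
... | yes _   = refl
... | no 0≮z = contradiction 0<z 0≮z

node≤1 : ∀ a b c → node a b c ≤ 1
node≤1 false false false = z≤n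
node≤1 false false true  = s≤s z≤n
node≤1 false true  _     = z≤n
node≤1 true  false _     = z≤n
node≤1 true  true  false = s≤s z≤n
node≤1 true  true  true  = z≤n

+-nonneg-cancel : ∀ {a b} → 0ℤ ≤ℤ a → 0ℤ ≤ℤ b → a +ℤ b ≤ℤ 0ℤ → a ≡ 0ℤ × b ≡ 0ℤ
+-nonneg-cancel {+ zero}  {+ zero}  _ _ _ = refl , refl
+-nonneg-cancel {+ zero}  {+ suc _} _ _ (+≤+ ())
+-nonneg-cancel {+ suc _} {+ _}     _ _ (+≤+ ())

+-nonpos-cancel : ∀ {a b} → a ≤ℤ 0ℤ → b ≤ℤ 0ℤ → 0ℤ ≤ℤ a +ℤ b → a ≡ 0ℤ × b ≡ 0ℤ
+-nonpos-cancel {+ zero}   {+ zero}   _ _ _ = refl , refl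
+-nonpos-cancel {+ zero}   { -[1+ _ ]} _ _ ()
+-nonpos-cancel { -[1+ _ ]} {+ zero}   _ _ ()
+-nonpos-cancel { -[1+ _ ]} { -[1+ _ ]} _ _ ()
+-nonpos-cancel {+ suc _}  (+≤+ ()) _ _
+-nonpos-cancel {+ zero}  {+ suc _} _ (+≤+ ()) _
+-nonpos-cancel { -[1+ _ ]} {+ suc _} _ (+≤+ ()) _

-- At a node with `x` not positive, the two sides of the balance equation have opposite weak signs.
-- Hence both are zero, and so are `a` and `b`, which have the same weak sign.
node-positive : ∀ {s t r a b c x} → Agrees s a → Agrees t b → Agrees r c →
  0ℤ ≤ℤ x → x +ℤ c ≡ a +ℤ b →
  node s t r ≤ ⟦ x >0⟧ ⊎ (a ≡ 0ℤ × b ≡ 0ℤ)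
node-positive {s} {t} {r} {x = x} As At Ar 0≤x e with 0ℤ ℤ.<? x
... | yes _ = inj₁ (node≤1 s t r)
node-positive {false} {false} {false} As At Ar 0≤x e | no _ = inj₁ z≤n
node-positive {false} {false} {true}  As At Ar 0≤x e | no _ =
  inj₂ (+-nonpos-cancel As At (subst (0ℤ ≤ℤ_) e (ℤ.+-mono-≤ 0≤x Ar)))
node-positive {false} {true}  As At Ar 0≤x e | no _ = inj₁ z≤n
node-positive {true}  {false} As At Ar 0≤x e | no _ = inj₁ z≤n
node-positive {true}  {true}  {false} As At Ar 0≤x e | no 0≮x =
  inj₂ (+-nonneg-cancel As At (subst (_≤ℤ 0ℤ) e (ℤ.+-mono-≤ (ℤ.≮⇒≥ 0≮x) Ar)))
node-positive {true}  {true}  {true}  As At Ar 0≤x e | no _ = inj₁ z≤n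

-- Adjacent zeros get different signs; the initial `true` serves the condition `first` of `Fits`.
alternating : (ℕ → ℤ) → ℕ → Bool
alternating f zero    = fill (f zero) true
alternating f (suc i) = fill (f (suc i)) (not (alternating f i))

agrees-alternating : ∀ f i → Agrees (alternating f i) (f i)
agrees-alternating f zero    = agrees-fill (f zero) _
agrees-alternating f (suc i) = agrees-fill (f (suc i)) _

glue : ℕ → (ℕ → Bool) → (ℕ → Bool) → ℕ → Bool
glue x f g i with i ℕ.<? x
... | yes _ = f i
... | no  _ = g i

glue-< : ∀ {x i} f g → i < x → glue x f g i ≡ f i
glue-< {x} {i} f g i<x with i ℕ.<? x
... | yes _   = refl
... | no i≮x = contradiction i<x i≮x

glue-≥ : ∀ {x i} f g → x ≤ i → glue x f g i ≡ g i
glue-≥ {x} {i} f g x≤i with i ℕ.<? x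
... | yes i<x = contradiction x≤i (ℕ.<⇒≱ i<x)
... | no _    = refl

+-pos : ∀ {a b} → 0ℤ <ℤ a +ℤ b → 0ℤ <ℤ a ⊎ 0ℤ <ℤ b
+-pos {a} {b} 0<a+b with 0ℤ ℤ.<? a | 0ℤ ℤ.<? b
... | yes 0<a | _       = inj₁ 0<a
... | no _    | yes 0<b = inj₂ 0<b
... | no 0≮a  | no 0≮b  =
  contradiction 0<a+b (ℤ.≤⇒≯ (ℤ.+-mono-≤ (ℤ.≮⇒≥ 0≮a) (ℤ.≮⇒≥ 0≮b)))

-- While `v k` is positive, one of its summands `x k` and `v (suc k)` is positive.
drop-positive : ∀ (v x : ℕ → ℤ) → (∀ k → x k +ℤ v (suc k) ≡ v k) → 0ℤ <ℤ v 0 →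
  ∀ n → 1 ≤ ∑ n (λ k → ⟦ x k >0⟧) ⊎ 0ℤ <ℤ v n
drop-positive v x e 0<v₀ zero = inj₂ 0<v₀
drop-positive v x e 0<v₀ (suc n) with drop-positive v x e 0<v₀ n
... | inj₁ h = inj₁ (ℕ.≤-trans h (ℕ.m≤m+n _ _))
... | inj₂ 0<vₙ with +-pos {x n} (subst (0ℤ <ℤ_) (sym (e n)) 0<vₙ)
...   | inj₁ 0<x = inj₁ (ℕ.≤-trans (ℕ.≤-reflexive (sym (⟦>0⟧-pos 0<x))) (ℕ.m≤n+m _ _))
...   | inj₂ 0<v = inj₂ 0<v

-- Potentials on a triangle of antidiagonals

-- Row k, position i stands for the lattice point (i , k − i).
module Triangle
  (u x : ℕ → ℕ → ℤ)
  (x≥0 : ∀ k i → i ≤ suc k → 0ℤ ≤ℤ x (suc k) i)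
  (bal-first : ∀ k → x (suc k) 0 +ℤ u (suc k) 0 ≡ u k 0)
  (bal-mid   : ∀ k i → i < k → x (suc k) (suc i) +ℤ u (suc k) (suc i) ≡ u k i +ℤ u k (suc i))
  (bal-last  : ∀ k → x (suc k) (suc k) +ℤ u (suc k) (suc k) ≡ u k k)
  where

  interior : ℕ → ℕ
  interior k = ∑ k (λ i → ⟦ x (suc k) (suc i) >0⟧)

  -- Fixed end signs make consecutive rows comparable by `changes-suc`; `true` is possible where the
  -- values on the two legs are nonnegative.
  record Fits (k : ℕ) (σ : ℕ → Bool) : Set where
    field
      agrees : ∀ i → i ≤ k → Agrees (σ i) (u k i)
      first  : σ 0 ≡ true
      last   : σ k ≡ true
  open Fits

  first-≥0 : ∀ {k} → 0ℤ ≤ℤ u (suc k) 0 → 0ℤ ≤ℤ u k 0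
  first-≥0 {k} h = subst (0ℤ ≤ℤ_) (bal-first k) (ℤ.+-mono-≤ (x≥0 k 0 z≤n) h)

  last-≥0 : ∀ {k} → 0ℤ ≤ℤ u (suc k) (suc k) → 0ℤ ≤ℤ u k k
  last-≥0 {k} h = subst (0ℤ ≤ℤ_) (bal-last k) (ℤ.+-mono-≤ (x≥0 k (suc k) ℕ.≤-refl) h)

  HasPositive : ℕ → Set
  HasPositive k = ∃[ i ] i ≤ k × 0ℤ <ℤ u k i

  -- As `x` is nonnegative, a positive value has a positive sum of predecessors.
  positive-pred : ∀ {k} → HasPositive (suc k) → HasPositive k
  positive-pred {k} (zero , _ , 0<u) =
    0 , z≤n , subst (0ℤ <ℤ_) (bal-first k) (ℤ.+-mono-≤-< (x≥0 k 0 z≤n) 0<u)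
  positive-pred {k} (suc i , s≤s i≤k , 0<u) with ℕ.m≤n⇒m<n∨m≡n i≤k
  ... | inj₂ refl = k , ℕ.≤-refl ,
    subst (0ℤ <ℤ_) (bal-last k) (ℤ.+-mono-≤-< (x≥0 k (suc k) ℕ.≤-refl) 0<u)
  ... | inj₁ i<k with +-pos {u k i}
        (subst (0ℤ <ℤ_) (bal-mid k i i<k) (ℤ.+-mono-≤-< (x≥0 k (suc i) (s≤s i≤k)) 0<u))
  ...   | inj₁ 0<a = i , i≤k , 0<a
  ...   | inj₂ 0<b = suc i , i<k , 0<b

  positive-root : ∀ k → HasPositive k → 0ℤ <ℤ u 0 0
  positive-root zero    (zero , z≤n , 0<u) = 0<u
  positive-root (suc k) h = positive-root k (positive-pred h)

  -- The cut is at a positive value, where the sign is forced, so each rule only has to be right at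
  -- its own end.
  glue-fits : ∀ {k p} {f g : ℕ → Bool} → p ≤ k → 0ℤ <ℤ u k p →
    (∀ i → i ≤ k → Agrees (f i) (u k i)) → (∀ i → i ≤ k → Agrees (g i) (u k i)) →
    f 0 ≡ true → g k ≡ true → Fits k (glue p f g)
  glue-fits {k} {p} {f} {g} p≤k 0<u Af Ag f₀ gₖ = record
    { agrees = agr ; first = fst p 0<u ; last = trans (glue-≥ f g p≤k) gₖ }
    where
    agr : ∀ i → i ≤ k → Agrees (glue p f g i) (u k i)
    agr i i≤k with i ℕ.<? p
    ... | yes _ = Af i i≤k
    ... | no  _ = Ag i i≤k
    fst : ∀ p → 0ℤ <ℤ u k p → glue p f g 0 ≡ true
    -- With the cut at 0 the left part is empty, but the value there is positive.
    fst zero    0<u = agrees-true (Ag 0 z≤n) 0<u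
    fst (suc p) _   = f₀

  -- Two adjacent zeros could be separated by the cut only if `p` were `suc i`, which holds a zero.
  same-side : ∀ {k p i} → 0ℤ <ℤ u k p → u k i ≡ 0ℤ → u k (suc i) ≡ 0ℤ → suc i < p ⊎ p ≤ i
  same-side {k} {p} {i} 0<u z z′ with p ℕ.≤? i
  ... | yes p≤i = inj₂ p≤i
  ... | no p≰i with ℕ.m≤n⇒m<n∨m≡n (ℕ.≰⇒> p≰i)
  ...   | inj₁ i+1<p = inj₁ i+1<p
  ...   | inj₂ refl  = contradiction 0<u (ℤ.≤⇒≯ (ℤ.≤-reflexive z′))

  -- Signs are chosen from the last row towards the origin: each zero of row `k` inherits the sign
  -- of one of its two successors.
  extend : ∀ {k σ} → Fits (suc k) σ → HasPositive k →
    ∃[ π ] Fits k π × changes (suc k) σ ≤ changes k π + 2 * interior k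
  extend {k} {σ} F (p , p≤k , 0<u) = π , G , (begin
    changes (suc k) σ              ≤⟨ changes-suc k π σ (trans (first F) (sym (first G))) (trans (last F) (sym (last G))) ⟩
    changes k π + 2 * nodes k π σ  ≤⟨ ℕ.+-monoʳ-≤ (changes k π) (ℕ.*-monoʳ-≤ 2 (∑-mono k node≤)) ⟩
    changes k π + 2 * interior k   ∎)
    where
    open ℕ.≤-Reasoning
    f g π : ℕ → Bool
    f i = fill (u k i) (σ i)
    g i = fill (u k i) (σ (suc i))
    π = glue p f g
    G : Fits k π
    G = glue-fits p≤k 0<u (λ i _ → agrees-fill (u k i) _) (λ i _ → agrees-fill (u k i) _)
      (trans (cong (fill (u k 0)) (first F))
        (fill-true (first-≥0 (subst (λ b → Agrees b (u (suc k) 0)) (first F) (agrees F 0 z≤n)))))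
      (trans (cong (fill (u k k)) (last F))
        (fill-true (last-≥0 (subst (λ b → Agrees b (u (suc k) (suc k))) (last F) (agrees F (suc k) ℕ.≤-refl)))))
    node≤ : ∀ i → i < k → node (π i) (π (suc i)) (σ (suc i)) ≤ ⟦ x (suc k) (suc i) >0⟧
    node≤ i i<k with node-positive (agrees G i (ℕ.<⇒≤ i<k)) (agrees G (suc i) i<k)
        (agrees F (suc i) (s≤s (ℕ.<⇒≤ i<k))) (x≥0 k (suc i) (s≤s (ℕ.<⇒≤ i<k))) (bal-mid k i i<k)
    ... | inj₁ h = h
    -- Both predecessors vanish and lie on one side of the cut, so one of them has copied the sign
    -- of this very point, which excludes a node.
    ... | inj₂ (z , z′) with same-side 0<u z z′
    ...   | inj₁ i+1<p rewrite glue-< f g i+1<p | fill-0 (σ (suc i)) z′ | node-copyʳ (π i) (σ (suc i)) = z≤n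
    ...   | inj₂ p≤i rewrite glue-≥ f g p≤i | fill-0 (σ (suc i)) z | node-copyˡ (σ (suc i)) (π (suc i)) = z≤n

  -- Descends by `extend` to row 0, which has no sign changes.
  changes≤ : ∀ k {σ} → HasPositive k → Fits k σ → changes k σ ≤ 2 * ∑ k interior
  changes≤ zero    h F = z≤n
  changes≤ (suc k) {σ} h F with positive-pred h
  ... | h′ with extend F h′
  ...   | π , G , le = begin
    changes (suc k) σ                    ≤⟨ le ⟩
    changes k π + 2 * interior k         ≤⟨ ℕ.+-monoˡ-≤ _ (changes≤ k h′ G) ⟩
    2 * ∑ k interior + 2 * interior k    ≡⟨ ℕ.*-distribˡ-+ 2 (∑ k interior) (interior k) ⟨
    2 * ∑ (suc k) interior               ∎
    where open ℕ.≤-Reasoning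

  row : ℕ → ℕ
  row k = ∑ (suc k) (λ i → ⟦ x k i >0⟧)

  row-suc : ∀ k → row (suc k) ≡ ⟦ x (suc k) 0 >0⟧ + interior k + ⟦ x (suc k) (suc k) >0⟧
  row-suc k = cong (_+ ⟦ x (suc k) (suc k) >0⟧) (∑-suc k (λ i → ⟦ x (suc k) i >0⟧))

  -- The last nonzero row

  module _ (n : ℕ) (u-top : ∀ i → i ≤ suc n → u (suc n) i ≡ 0ℤ) where

    -- Since row `suc n` is zero, `x` there is the sum of two neighbours on row `n`, or an end value
    -- alone. Thus a negative value is impossible at position 0 and elsewhere forces a positive left
    -- neighbour.
    positive-top : ∀ {i} → i ≤ n → u n i ≢ 0ℤ → HasPositive n
    positive-top {i} i≤n u≢0 with 0ℤ ℤ.<? u n i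
    ... | yes 0<u = i , i≤n , 0<u
    positive-top {zero} i≤n u≢0 | no 0≮u =
      contradiction (ℤ.≤-antisym (ℤ.≮⇒≥ 0≮u) (first-≥0 (ℤ.≤-reflexive (sym (u-top 0 z≤n))))) u≢0
    positive-top {suc i} i<n u≢0 | no 0≮u with 0ℤ ℤ.<? u n i
    ... | yes 0<u = i , ℕ.<⇒≤ i<n , 0<u
    ... | no 0≮a  = contradiction (proj₂ (+-nonpos-cancel (ℤ.≮⇒≥ 0≮a) (ℤ.≮⇒≥ 0≮u)
          (subst (0ℤ ≤ℤ_) (bal-mid n i i<n)
            (ℤ.+-mono-≤ (x≥0 n (suc i) (ℕ.m≤n⇒m≤1+n i<n))
              (ℤ.≤-reflexive (sym (u-top (suc i) (ℕ.m≤n⇒m≤1+n i<n)))))))) u≢0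

    -- Neighbours of different sign give a change. Neighbours of equal sign are not both zero, by
    -- alternation, so their sum, which is a value of `x`, is nonzero and hence positive.
    top-row : HasPositive n → ∃[ σ ] Fits n σ × n ≤ changes n σ + interior n
    top-row (p , p≤n , 0<u) = σ , F , n≤
      where
      reversed : ℕ → ℤ
      reversed j = u n (n ∸ j)
      f g σ : ℕ → Bool
      f   = alternating (u n)
      -- Alternates inwards from the right end, so that a zero at position `n` gets `true`.
      g i = alternating reversed (n ∸ i)
      σ   = glue p f g
      F : Fits n σ
      F = glue-fits p≤n 0<u (λ i _ → agrees-alternating (u n) i)
        (λ i i≤n → subst (Agrees (g i)) (cong (u n) (ℕ.m∸[m∸n]≡n i≤n)) (agrees-alternating reversed (n ∸ i)))
        (fill-true (first-≥0 (ℤ.≤-reflexive (sym (u-top 0 z≤n)))))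
        (trans (cong (alternating reversed) (ℕ.n∸n≡0 n))
          (fill-true (last-≥0 (ℤ.≤-reflexive (sym (u-top (suc n) ℕ.≤-refl))))))

      δ-node : ∀ a b → 1 ≤ δ a b + node a b (not a)
      δ-node false false = ℕ.≤-refl
      δ-node false true  = ℕ.≤-refl
      δ-node true  false = ℕ.≤-refl
      δ-node true  true  = ℕ.≤-refl

      δ-not : ∀ a → δ a (not a) ≡ 1
      δ-not false = refl
      δ-not true  = refl

      δ-notˡ : ∀ a → δ (not a) a ≡ 1
      δ-notˡ false = refl
      δ-notˡ true  = refl

      g-step : ∀ {i} → i < n → u n i ≡ 0ℤ → g i ≡ not (g (suc i))
      g-step {i} i<n z with n ∸ i | ℕ.+-∸-assoc 1 i<n | ℕ.m∸[m∸n]≡n (ℕ.<⇒≤ i<n)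
      -- Exposing `n ∸ i` as a successor lets `alternating` unfold.
      ... | .(suc (n ∸ suc i)) | refl | e = fill-0 _ (trans (cong (u n) e) z)

      1≤ : ∀ i → i < n → 1 ≤ δ (σ i) (σ (suc i)) + ⟦ x (suc n) (suc i) >0⟧
      -- The zero at `suc i` on row `suc n` agrees with any sign; giving it `not (σ i)` turns equal
      -- neighbours into a node.
      1≤ i i<n with node-positive (agrees F i (ℕ.<⇒≤ i<n)) (agrees F (suc i) i<n)
          (subst (Agrees (not (σ i))) (sym (u-top (suc i) (ℕ.m≤n⇒m≤1+n i<n))) (agrees-0 (not (σ i))))
          (x≥0 n (suc i) (ℕ.m≤n⇒m≤1+n i<n)) (bal-mid n i i<n)
      ... | inj₁ h = ℕ.≤-trans (δ-node (σ i) (σ (suc i))) (ℕ.+-monoʳ-≤ (δ (σ i) (σ (suc i))) h)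
      ... | inj₂ (z , z′) with same-side 0<u z z′
      ...   | inj₁ i+1<p rewrite glue-< f g i+1<p | glue-< f g (ℕ.<⇒≤ i+1<p)
                | fill-0 (not (f i)) z′ | δ-not (f i) = s≤s z≤n
      ...   | inj₂ p≤i rewrite glue-≥ f g p≤i | glue-≥ f g (ℕ.m≤n⇒m≤1+n p≤i)
                | g-step i<n z | δ-notˡ (g (suc i)) = s≤s z≤n

      ∑1 : ∀ m → ∑ m (λ _ → 1) ≡ m
      ∑1 zero    = refl
      ∑1 (suc m) = trans (ℕ.+-comm (∑ m (λ _ → 1)) 1) (cong suc (∑1 m))

      n≤ : n ≤ changes n σ + interior n
      n≤ = subst₂ _≤_ (∑1 n) (∑-+ n _ _) (∑-mono n 1≤)

    n≤interior : HasPositive n → n ≤ 2 * ∑ (suc n) interior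
    n≤interior h with top-row h
    ... | σ , F , le = begin
      n                                  ≤⟨ le ⟩
      changes n σ + interior n           ≤⟨ ℕ.+-mono-≤ (changes≤ n h F) (ℕ.m≤n*m (interior n) 2) ⟩
      2 * ∑ n interior + 2 * interior n  ≡⟨ ℕ.*-distribˡ-+ 2 (∑ n interior) (interior n) ⟨
      2 * ∑ (suc n) interior             ∎
      where open ℕ.≤-Reasoning

    positive-count : HasPositive n → n + 4 ≤ 2 * ∑ (suc (suc n)) row
    positive-count h = begin
      n + 4                                         ≤⟨ ℕ.+-monoˡ-≤ 4 (n≤interior h) ⟩
      2 * ∑ (suc n) interior + 4                    ≡⟨ shuffle (∑ (suc n) interior) ⟩
      2 * (1 + ∑ (suc n) interior + 1)              ≤⟨ ℕ.*-monoʳ-≤ 2 (ℕ.+-mono-≤ (ℕ.+-monoˡ-≤ (∑ (suc n) interior) first≥1) last≥1) ⟩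
      2 * (∑ (suc n) a + ∑ (suc n) interior + ∑ (suc n) b)
                                                    ≡⟨ cong (2 *_) (trans (cong (_+ ∑ (suc n) b) (sym (∑-+ (suc n) a interior))) (sym (∑-+ (suc n) _ b))) ⟩
      2 * ∑ (suc n) (λ k → a k + interior k + b k)  ≡⟨ cong (2 *_) (∑-cong (suc n) (sym ∘ row-suc)) ⟩
      2 * ∑ (suc n) (row ∘ suc)                     ≤⟨ ℕ.*-monoʳ-≤ 2 (ℕ.m≤n+m _ (row 0)) ⟩
      2 * (row 0 + ∑ (suc n) (row ∘ suc))           ≡⟨ cong (2 *_) (∑-suc (suc n) row) ⟨
      2 * ∑ (suc (suc n)) row                       ∎
      where
      open ℕ.≤-Reasoning
      a b : ℕ → ℕ
      a k = ⟦ x (suc k) 0 >0⟧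
      b k = ⟦ x (suc k) (suc k) >0⟧
      shuffle : ∀ s → 2 * s + 4 ≡ 2 * (1 + s + 1)
      shuffle = solve-∀
      0<u₀ : 0ℤ <ℤ u 0 0
      0<u₀ = positive-root n h
      exhausted : ∀ {m z} → m ⊎ 0ℤ <ℤ z → z ≡ 0ℤ → m
      exhausted (inj₁ h)   _    = h
      exhausted (inj₂ 0<0) refl = contradiction 0<0 (ℤ.<-irrefl refl)
      first≥1 : 1 ≤ ∑ (suc n) a
      first≥1 = exhausted (drop-positive (λ k → u k 0) (λ k → x (suc k) 0) bal-first 0<u₀ (suc n)) (u-top 0 z≤n)
      last≥1 : 1 ≤ ∑ (suc n) b
      last≥1 = exhausted (drop-positive (λ k → u k k) (λ k → x (suc k) (suc k)) bal-last 0<u₀ (suc n)) (u-top (suc n) ℕ.≤-refl)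

ZeroRow : (ℕ → ℕ → ℤ) → ℕ → Set
ZeroRow u k = ∀ i → i ≤ k → u k i ≡ 0ℤ

zeroRow-or-nonzero : ∀ u k → ZeroRow u k ⊎ ∃[ i ] i ≤ k × u k i ≢ 0ℤ
zeroRow-or-nonzero u k with ℕ.anyUpTo? (λ i → ¬? (u k i ℤ.≟ 0ℤ)) (suc k)
... | yes (i , s≤s i≤k , u≢0) = inj₂ (i , i≤k , u≢0)
... | no ∄ = inj₁ λ i i≤k → decidable-stable (u k i ℤ.≟ 0ℤ) λ u≢0 → ∄ (i , s≤s i≤k , u≢0)

last-nonzero-row : ∀ u e m → (∀ k → m ≤ k → ZeroRow u k) →
  (∃[ n ] e ≤ n × n < m × ZeroRow u (suc n) × ∃[ i ] i ≤ n × u n i ≢ 0ℤ)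
  ⊎ (∀ k → e ≤ k → ZeroRow u k)
last-nonzero-row u e zero    Z = inj₂ λ k _ → Z k z≤n
last-nonzero-row u e (suc m) Z with e ℕ.≤? m
... | no e≰m = inj₂ λ k e≤k → Z k (ℕ.≤-trans (ℕ.≰⇒> e≰m) e≤k)
... | yes e≤m with zeroRow-or-nonzero u m
...   | inj₂ nz = inj₁ (m , e≤m , ℕ.≤-refl , Z (suc m) ℕ.≤-refl , nz)
...   | inj₁ Zm with last-nonzero-row u e m Z′
  where
  Z′ : ∀ k → m ≤ k → ZeroRow u k
  Z′ k m≤k with ℕ.m≤n⇒m<n∨m≡n m≤k
  ... | inj₁ m<k  = Z k m<k
  ... | inj₂ refl = Zm
...     | inj₁ (n , e≤n , n<m , rest) = inj₁ (n , e≤n , ℕ.m<n⇒m<1+n n<m , rest)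
...     | inj₂ h = inj₂ h

module _ {d : ℕ} {w : Config} (Φ : Potential d w) (valid : Valid w) where
  open Potential Φ

  u x : ℕ → ℕ → ℤ
  u k i = q i (k ∸ i)
  x k i = w i (k ∸ i)

  x≥0 : ∀ k i → i ≤ suc k → 0ℤ ≤ℤ x (suc k) i
  x≥0 k zero    _ = valid 0 (suc k) λ ()
  x≥0 k (suc i) _ = valid (suc i) (k ∸ i) λ ()

  bal-first : ∀ k → x (suc k) 0 +ℤ u (suc k) 0 ≡ u k 0
  bal-first k = trans (balance 0 (suc k)) (ℤ.+-identityˡ _)

  bal-mid : ∀ k i → i < k → x (suc k) (suc i) +ℤ u (suc k) (suc i) ≡ u k i +ℤ u k (suc i)
  bal-mid k i i<k = trans (balance (suc i) (k ∸ i))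
    (cong (u k i +ℤ_) (cong (below q (suc i)) (ℕ.+-∸-assoc 1 i<k)))

  bal-last : ∀ k → x (suc k) (suc k) +ℤ u (suc k) (suc k) ≡ u k k
  bal-last k = trans (balance (suc k) (k ∸ k))
    (trans (cong (λ m → u k k +ℤ below q (suc k) m) (ℕ.n∸n≡0 k)) (ℤ.+-identityʳ _))

  u-vanishes : ∀ k → d ≤ k → ZeroRow u k
  u-vanishes k d≤k i i≤k = vanishes i (k ∸ i) (subst (d ≤_) (sym (ℕ.m+[n∸m]≡n i≤k)) d≤k)

  zero-rows⇒deg≤ : ∀ n → (∀ k → n ≤ k → ZeroRow u k) → DegLe w n
  zero-rows⇒deg≤ n Z i j w≢0 with i + j ℕ.≤? n
  ... | yes i+j≤n = i+j≤n
  ... | no i+j≰n = contradiction (w≡0 i j (ℕ.≰⇒> i+j≰n)) w≢0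
    where
    q≡0 : ∀ i j → n ≤ i + j → q i j ≡ 0ℤ
    q≡0 i j h = trans (cong (q i) (sym (ℕ.m+n∸m≡n i j))) (Z (i + j) h i (ℕ.m≤m+n i j))
    left≡0 : ∀ i j → n < i + j → left q i j ≡ 0ℤ
    left≡0 zero    j h = refl
    left≡0 (suc i) j h = q≡0 i j (s≤s⁻¹ h)
    below≡0 : ∀ i j → n < i + j → below q i j ≡ 0ℤ
    below≡0 i zero    h = refl
    below≡0 i (suc j) h = q≡0 i j (s≤s⁻¹ (subst (n <_) (ℕ.+-suc i j) h))
    w≡0 : ∀ i j → n < i + j → w i j ≡ 0ℤ
    w≡0 i j h = trans (sym (ℤ.+-identityʳ _)) (trans (cong (w i j +ℤ_) (sym (q≡0 i j (ℕ.<⇒≤ h))))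
      (trans (balance i j) (cong₂ _+ℤ_ (left≡0 i j h) (below≡0 i j h))))

  degree-bound : ∀ n → 2 * suppPlusCard d w < n + 4 → DegLe w n
  degree-bound n few with last-nonzero-row u n d u-vanishes
  ... | inj₂ Z = zero-rows⇒deg≤ n Z
  ... | inj₁ (m , n≤m , m<d , Z , i , i≤m , u≢0) = contradiction few (ℕ.≤⇒≯ (begin
    n + 4                   ≤⟨ ℕ.+-monoˡ-≤ 4 n≤m ⟩
    m + 4                   ≤⟨ positive-count m Z (positive-top m Z i≤m u≢0) ⟩
    2 * ∑ (suc (suc m)) _   ≤⟨ ℕ.*-monoʳ-≤ 2 (∑-monoˡ _ (s≤s m<d)) ⟩
    2 * ∑ (suc d) _         ≡⟨ cong (2 *_) (suppPlusCard-∑ d w) ⟨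
    2 * suppPlusCard d w    ∎))
    where
    open ℕ.≤-Reasoning
    open Triangle u x x≥0 bal-first bal-mid bal-last

theorem7p2 : (d : ℕ) (w : Config) → Outcome d w → Valid w
    → suppPlusCard d w ≡ 5 → DegLe w 7
theorem7p2 d w outcome valid card =
  degree-bound (outcome-potential outcome) valid 7
    (subst (λ c → 2 * c < 11) (sym card) ℕ.≤-refl)
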